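{- As formal power series in $q$ (equivalently, for complex $q$ with $|q|<1$), $$\sum_{n\ge 0}\frac{q^{2n^2+n}}{(q;q)_{2n+1}}=\frac{1}{(q;q)_\infty}\sum_{k\in\mathbb{Z}}(-1)^kq^{3k^2-k}=\frac{(q^2;q^2)_\infty}{(q;q)_\infty}=(-q;q)_\infty .$$
   Context: $(z;q)_n=\prod_{j=0}^{n-1}(1-q^jz)$ and $(z;q)_\infty=\prod_{j\ge0}(1-q^jz)$; thus $(q;q)_\infty=\prod_{j\ge1}(1-q^j)$, $(q^2;q^2)_\infty=\prod_{j\ge1}(1-q^{2j})$, $(-q;q)_\infty=\prod_{j\ge1}(1+q^j)$. -}

module Defs where

open import Data.Fin.Base as Fin using (Fin; toℕ)
open import Data.Fin.Properties using (toℕ<n)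
open import Data.Integer.Base as ℤ using (ℤ; +_; -[1+_]; 0ℤ; 1ℤ; -1ℤ; ∣_∣)
import Data.Integer.Properties as ℤ
import Data.Integer.Tactic.RingSolver as ℤ-Solver
open import Data.Nat.Base as ℕ using (ℕ; zero; suc; z≤n; s≤s; _∸_)
import Data.Nat.Properties as ℕ
open import Data.Product.Base using (Σ-syntax; _×_; _,_; proj₁)
open import Data.Vec.Functional using (Vector; _∷_; [])
open import Function.Base using (_∘_)
open import Relation.Binary.PropositionalEquality

open import Algebra.Properties.Monoid.Sum ℤ.+-0-monoid public
  using (sum; sum-syntax; sum⁺-syntax; sum-cong-≗; sum-replicate-zero)

open ≡-Reasoning

-- Formal power series in q over ℤ, as coefficient sequences.  Equality of
-- series is equality of all coefficients, i.e. _≗_.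

Series : Set
Series = ℕ → ℤ

infix  8 -ₛ_
infixr 8 _^ₛ_
infixl 7 _*ₛ_ _/ₛ_
infixr 7 _·_
infixl 6 _+ₛ_ _-ₛ_

0ₛ 1ₛ q : Series
0ₛ _       = 0ℤ

1ₛ zero    = 1ℤ
1ₛ (suc _) = 0ℤ

q 1        = 1ℤ
q _        = 0ℤ

_+ₛ_ _-ₛ_ _*ₛ_ : Series → Series → Series
(f +ₛ g) n = f n ℤ.+ g n
(f -ₛ g) n = f n ℤ.- g n
(f *ₛ g) n = ∑[ i ≤ n ] (f (toℕ i) ℤ.* g (n ∸ toℕ i))

-ₛ_ : Series → Series
(-ₛ f) n = ℤ.- f n

_·_ : ℤ → Series → Series
(c · f) n = c ℤ.* f n

_^ₛ_ : Series → ℕ → Series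
f ^ₛ zero  = 1ₛ
f ^ₛ suc n = f *ₛ f ^ₛ n

-- The reciprocal h of a series g with g₀ = 1 solves g h = 1 coefficientwise:
--   hₙ = [n = 0] - ∑_{i < n} gᵢ₊₁ hₙ₋₁₋ᵢ.
-- The vector  recipPrefix g n  is (hₙ₋₁ , … , h₀).

mutual
  recipPrefix : Series → (n : ℕ) → Vector ℤ n
  recipPrefix g zero    = []
  recipPrefix g (suc n) = recipCoeff g n ∷ recipPrefix g n

  recipCoeff : Series → Series
  recipCoeff g n = 1ₛ n ℤ.- ∑[ i < n ] (g (suc (toℕ i)) ℤ.* recipPrefix g n i)

-- The operations below are total, but mean reciprocal and quotient only when
-- g₀ = 1 (recip-inverseʳ).  This holds for every denominator used: see
-- ⟨⨾⟩-constant and ⟨⨾⟩∞-constant.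

recip : Series → Series
recip = recipCoeff

_/ₛ_ : Series → Series → Series
f /ₛ g = f *ₛ recip g

recipPrefix-recipCoeff : ∀ g n (i : Fin n) →
  recipPrefix g n i ≡ recipCoeff g (n ∸ suc (toℕ i))
recipPrefix-recipCoeff g (suc n) Fin.zero    = refl
recipPrefix-recipCoeff g (suc n) (Fin.suc i) = recipPrefix-recipCoeff g n i

recip-inverseʳ : ∀ g → g 0 ≡ 1ℤ → g *ₛ recip g ≗ 1ₛ
recip-inverseʳ g g₀ n = begin
  g 0 ℤ.* h n ℤ.+ ∑[ i < n ] (g (suc (toℕ i)) ℤ.* h (n ∸ suc (toℕ i)))
    ≡⟨ cong₂ ℤ._+_ (trans (cong (ℤ._* h n) g₀) (ℤ.*-identityˡ (h n)))
         (sum-cong-≗ λ i → cong (g (suc (toℕ i)) ℤ.*_)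
                                (sym (recipPrefix-recipCoeff g n i))) ⟩
  1ₛ n ℤ.- s ℤ.+ s
    ≡⟨ cancel (1ₛ n) s ⟩
  1ₛ n ∎
  where
  h = recipCoeff g
  s = ∑[ i < n ] (g (suc (toℕ i)) ℤ.* recipPrefix g n i)
  cancel : ∀ a b → a ℤ.- b ℤ.+ b ≡ a
  cancel = ℤ-Solver.solve-∀

-- Limits are taken in the q-adic topology: every coefficient is eventually
-- constant.

Converges : (ℕ → Series) → Set
Converges s = ∀ N → Σ[ M ∈ ℕ ] (∀ m → M ℕ.≤ m → s m N ≡ s M N)

lim : (s : ℕ → Series) → Converges s → Series
lim s c N = s (proj₁ (c N)) N

partialSum : (ℕ → Series) → ℕ → Series
partialSum a zero    = 0ₛ
partialSum a (suc m) = partialSum a m +ₛ a m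

Summable : (ℕ → Series) → Set
Summable a = Converges (partialSum a)

∑∞ : (a : ℕ → Series) → Summable a → Series
∑∞ a c = lim (partialSum a) c

-- A bilateral series converges when both of its halves do.

Summableℤ : (ℤ → Series) → Set
Summableℤ a = Summable (λ n → a (+ n)) × Summable (λ n → a -[1+ n ])

∑ℤ : (a : ℤ → Series) → Summableℤ a → Series
∑ℤ a (c⁺ , c⁻) = ∑∞ (λ n → a (+ n)) c⁺ +ₛ ∑∞ (λ n → a -[1+ n ]) c⁻

-- ⟨ z ⨾ p ⟩[ n ] = ∏_{j < n} (1 - pʲ z)

⟨_⨾_⟩[_] : Series → Series → ℕ → Series
⟨ z ⨾ p ⟩[ zero  ] = 1ₛ
⟨ z ⨾ p ⟩[ suc n ] = ⟨ z ⨾ p ⟩[ n ] *ₛ (1ₛ -ₛ p ^ₛ n *ₛ z)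

-- Order≥ n f: the series f is divisible by qⁿ.

Order≥ : ℕ → Series → Set
Order≥ n f = ∀ i → i ℕ.< n → f i ≡ 0ℤ

sum-zero : ∀ {n} (t : Vector ℤ n) → (∀ i → t i ≡ 0ℤ) → sum t ≡ 0ℤ
sum-zero {n} t t≡0 = trans (sum-cong-≗ t≡0) (sum-replicate-zero n)

order-≤ : ∀ {m n} f → m ℕ.≤ n → Order≥ n f → Order≥ m f
order-≤ f m≤n o i i<m = o i (ℕ.<-≤-trans i<m m≤n)

order-*ₛ : ∀ {n} f g → Order≥ n f → Order≥ n (f *ₛ g)
order-*ₛ f g o i i<n = sum-zero _ λ j →
  cong (ℤ._* g (i ∸ toℕ j)) (o (toℕ j) (ℕ.≤-<-trans (ℕ.≤-pred (toℕ<n j)) i<n))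

order-· : ∀ {n} c f → Order≥ n f → Order≥ n (c · f)
order-· c f o i i<n = trans (cong (c ℤ.*_) (o i i<n)) (ℤ.*-zeroʳ c)

order-^ₛ : ∀ f → f 0 ≡ 0ℤ → ∀ n → Order≥ n (f ^ₛ n)
order-^ₛ f f₀ (suc n) i i<1+n = sum-zero _ (term i i<1+n)
  where
  term : ∀ i → i ℕ.< suc n → (j : Fin (suc i)) →
         f (toℕ j) ℤ.* (f ^ₛ n) (i ∸ toℕ j) ≡ 0ℤ
  term i       _         Fin.zero    = cong (ℤ._* (f ^ₛ n) i) f₀
  term (suc i) (s≤s i<n) (Fin.suc j) = trans
    (cong (f (suc (toℕ j)) ℤ.*_)
      (order-^ₛ f f₀ n (i ∸ toℕ j) (ℕ.≤-<-trans (ℕ.m∸n≤m i (toℕ j)) i<n)))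
    (ℤ.*-zeroʳ (f (suc (toℕ j))))

*ₛ-identityʳ : ∀ f → f *ₛ 1ₛ ≗ f
*ₛ-identityʳ f zero    = trans (ℤ.+-identityʳ _) (ℤ.*-identityʳ (f 0))
*ₛ-identityʳ f (suc n) = begin
  f 0 ℤ.* 0ℤ ℤ.+ ((f ∘ suc) *ₛ 1ₛ) n
    ≡⟨ cong₂ ℤ._+_ (ℤ.*-zeroʳ (f 0)) (*ₛ-identityʳ (f ∘ suc) n) ⟩
  0ℤ ℤ.+ f (suc n)
    ≡⟨ ℤ.+-identityˡ _ ⟩
  f (suc n) ∎

stabilises⇒converges : ∀ s → (∀ n i → i ℕ.< n → s (suc n) i ≡ s n i) → Converges s
stabilises⇒converges s step N = suc N , λ m N<m → go (ℕ.≤⇒≤′ N<m)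
  where
  go : ∀ {m} → suc N ℕ.≤′ m → s m N ≡ s (suc N) N
  go (ℕ.≤′-reflexive refl) = refl
  go (ℕ.≤′-step N<m)       = trans (step _ N (ℕ.≤′⇒≤ N<m)) (go N<m)

order⇒summable : ∀ a → (∀ n → Order≥ n (a n)) → Summable a
order⇒summable a o = stabilises⇒converges (partialSum a) λ n i i<n →
  trans (cong (λ x → partialSum a n i ℤ.+ x) (o n i i<n)) (ℤ.+-identityʳ _)

⟨⨾⟩-converges : ∀ z p → p 0 ≡ 0ℤ → Converges ⟨ z ⨾ p ⟩[_]
⟨⨾⟩-converges z p p₀ = stabilises⇒converges _ λ n i i<n → trans
  (sum-cong-≗ λ (j : Fin (suc i)) → cong (⟨ z ⨾ p ⟩[ n ] (toℕ j) ℤ.*_)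
    (factor n (i ∸ toℕ j) (ℕ.≤-<-trans (ℕ.m∸n≤m i (toℕ j)) i<n)))
  (*ₛ-identityʳ ⟨ z ⨾ p ⟩[ n ] i)
  where
  factor : ∀ n i → i ℕ.< n → (1ₛ -ₛ p ^ₛ n *ₛ z) i ≡ 1ₛ i
  factor n i i<n = trans
    (cong (λ x → 1ₛ i ℤ.- x) (order-*ₛ (p ^ₛ n) z (order-^ₛ p p₀ n) i i<n))
    (ℤ.+-identityʳ (1ₛ i))

-- ⟨ z ⨾ p ⟩∞[ p₀ ] = ∏_{j ≥ 0} (1 - pʲ z).  It converges because p is
-- divisible by q, which p₀ records.

⟨_⨾_⟩∞[_] : (z p : Series) → p 0 ≡ 0ℤ → Series
⟨ z ⨾ p ⟩∞[ p₀ ] = lim ⟨ z ⨾ p ⟩[_] (⟨⨾⟩-converges z p p₀)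

q₀ : q 0 ≡ 0ℤ
q₀ = refl

q²₀ : (q ^ₛ 2) 0 ≡ 0ℤ
q²₀ = refl

⟨⨾⟩-constant : ∀ z p n → z 0 ≡ 0ℤ → ⟨ z ⨾ p ⟩[ n ] 0 ≡ 1ℤ
⟨⨾⟩-constant z p zero    z₀ = refl
⟨⨾⟩-constant z p (suc n) z₀ = begin
  (⟨ z ⨾ p ⟩[ n ] *ₛ (1ₛ -ₛ p ^ₛ n *ₛ z)) 0
    ≡⟨ ℤ.+-identityʳ _ ⟩
  ⟨ z ⨾ p ⟩[ n ] 0 ℤ.* (1ℤ ℤ.- ((p ^ₛ n) 0 ℤ.* z 0 ℤ.+ 0ℤ))
    ≡⟨ cong₂ (λ x y → x ℤ.* (1ℤ ℤ.- ((p ^ₛ n) 0 ℤ.* y ℤ.+ 0ℤ)))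
             (⟨⨾⟩-constant z p n z₀) z₀ ⟩
  1ℤ ℤ.* (1ℤ ℤ.- ((p ^ₛ n) 0 ℤ.* 0ℤ ℤ.+ 0ℤ))
    ≡⟨ cong (λ x → 1ℤ ℤ.* (1ℤ ℤ.- (x ℤ.+ 0ℤ))) (ℤ.*-zeroʳ ((p ^ₛ n) 0)) ⟩
  1ℤ ∎

⟨⨾⟩∞-constant : ∀ z p p₀ → z 0 ≡ 0ℤ → ⟨ z ⨾ p ⟩∞[ p₀ ] 0 ≡ 1ℤ
⟨⨾⟩∞-constant z p p₀ z₀ = ⟨⨾⟩-constant z p 1 z₀

-- The exponent 3k² - k is nonnegative, so the absolute value only serves to
-- read it as a natural number (see +3k²-k).  Likewise (-1)ᵏ = (-1)^∣k∣.

3k²-k : ℤ → ℕ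
3k²-k k = ∣ + 3 ℤ.* (k ℤ.* k) ℤ.- k ∣

sign : ℤ → ℤ
sign k = -1ℤ ℤ.^ ∣ k ∣

private
  pos-+-* : ∀ a b m → + (m ℕ.* m ℕ.* 3 ℕ.+ (a ℕ.* m ℕ.+ b))
                      ≡ + m ℤ.* + m ℤ.* + 3 ℤ.+ (+ a ℤ.* + m ℤ.+ + b)
  pos-+-* a b m = begin
    + (m ℕ.* m ℕ.* 3 ℕ.+ (a ℕ.* m ℕ.+ b))
      ≡⟨ ℤ.pos-+ (m ℕ.* m ℕ.* 3) (a ℕ.* m ℕ.+ b) ⟩
    + (m ℕ.* m ℕ.* 3) ℤ.+ + (a ℕ.* m ℕ.+ b)
      ≡⟨ cong₂ ℤ._+_ (trans (ℤ.pos-* (m ℕ.* m) 3) (cong (ℤ._* + 3) (ℤ.pos-* m m)))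
           (trans (ℤ.pos-+ (a ℕ.* m) b) (cong (λ x → x ℤ.+ + b) (ℤ.pos-* a m))) ⟩
    + m ℤ.* + m ℤ.* + 3 ℤ.+ (+ a ℤ.* + m ℤ.+ + b) ∎

  3k²-k-suc : ∀ m → + 3 ℤ.* (+ suc m ℤ.* + suc m) ℤ.- + suc m
                    ≡ + (m ℕ.* m ℕ.* 3 ℕ.+ (5 ℕ.* m ℕ.+ 2))
  3k²-k-suc m = trans (expand (+ m)) (sym (pos-+-* 5 2 m))
    where
    expand : ∀ x → + 3 ℤ.* ((1ℤ ℤ.+ x) ℤ.* (1ℤ ℤ.+ x)) ℤ.- (1ℤ ℤ.+ x)
                   ≡ x ℤ.* x ℤ.* + 3 ℤ.+ (+ 5 ℤ.* x ℤ.+ + 2)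
    expand = ℤ-Solver.solve-∀

  3k²-k-neg : ∀ m → + 3 ℤ.* (-[1+ m ] ℤ.* -[1+ m ]) ℤ.- -[1+ m ]
                    ≡ + (m ℕ.* m ℕ.* 3 ℕ.+ (7 ℕ.* m ℕ.+ 4))
  3k²-k-neg m = trans (expand (+ m)) (sym (pos-+-* 7 4 m))
    where
    expand : ∀ x → + 3 ℤ.* (ℤ.- (1ℤ ℤ.+ x) ℤ.* ℤ.- (1ℤ ℤ.+ x)) ℤ.- ℤ.- (1ℤ ℤ.+ x)
                   ≡ x ℤ.* x ℤ.* + 3 ℤ.+ (+ 7 ℤ.* x ℤ.+ + 4)
    expand = ℤ-Solver.solve-∀

+3k²-k : ∀ k → + 3k²-k k ≡ + 3 ℤ.* (k ℤ.* k) ℤ.- k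
+3k²-k (+ zero)  = refl
+3k²-k (+ suc m) = trans (cong (+_ ∘ ∣_∣) (3k²-k-suc m)) (sym (3k²-k-suc m))
+3k²-k -[1+ m ]  = trans (cong (+_ ∘ ∣_∣) (3k²-k-neg m)) (sym (3k²-k-neg m))

∣k∣≤3k²-k : ∀ k → ∣ k ∣ ℕ.≤ 3k²-k k
∣k∣≤3k²-k (+ zero)  = z≤n
∣k∣≤3k²-k (+ suc m) = subst (suc m ℕ.≤_) (sym (cong ∣_∣ (3k²-k-suc m)))
  (ℕ.m≤n⇒m≤o+n (m ℕ.* m ℕ.* 3)
    (subst (ℕ._≤ 5 ℕ.* m ℕ.+ 2) (ℕ.+-comm m 1) (ℕ.+-mono-≤ (ℕ.m≤n*m m 5) (s≤s z≤n))))
∣k∣≤3k²-k -[1+ m ]  = subst (suc m ℕ.≤_) (sym (cong ∣_∣ (3k²-k-neg m)))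
  (ℕ.m≤n⇒m≤o+n (m ℕ.* m ℕ.* 3)
    (subst (ℕ._≤ 7 ℕ.* m ℕ.+ 4) (ℕ.+-comm m 1) (ℕ.+-mono-≤ (ℕ.m≤n*m m 7) (s≤s z≤n))))

order-q^ : ∀ {m n} → m ℕ.≤ n → Order≥ m (q ^ₛ n)
order-q^ {n = n} m≤n = order-≤ (q ^ₛ n) m≤n (order-^ₛ q q₀ n)

q^[2n²+n]/⟨q⨾q⟩-summable :
  Summable (λ n → q ^ₛ (2 ℕ.* n ℕ.^ 2 ℕ.+ n) /ₛ ⟨ q ⨾ q ⟩[ 2 ℕ.* n ℕ.+ 1 ])
q^[2n²+n]/⟨q⨾q⟩-summable = order⇒summable _ λ n →
  order-*ₛ (q ^ₛ (2 ℕ.* n ℕ.^ 2 ℕ.+ n)) (recip ⟨ q ⨾ q ⟩[ 2 ℕ.* n ℕ.+ 1 ])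
    (order-q^ (ℕ.m≤n+m n (2 ℕ.* n ℕ.^ 2)))

sign·q^[3k²-k]-summable : Summableℤ (λ k → sign k · q ^ₛ 3k²-k k)
sign·q^[3k²-k]-summable =
    order⇒summable _ (λ n → order-· (sign (+ n)) (q ^ₛ 3k²-k (+ n))
      (order-q^ (∣k∣≤3k²-k (+ n))))
  , order⇒summable _ (λ n → order-· (sign -[1+ n ]) (q ^ₛ 3k²-k -[1+ n ])
      (order-q^ (ℕ.<⇒≤ (∣k∣≤3k²-k -[1+ n ]))))

{-# OPTIONS --safe #-}
-- Euler's product.  With E_j = ∑_m q^{m(m+1)/2 + jm} / (q; q)_m one has
-- E_j = (1 + q^{j+1}) E_{j+1}, and E_j → 1, so E_0 = (-q; q)_∞.  The terms
-- m = 2n and m = 2n + 1 of E_0 add up to q^{2n²+n} / (q; q)_{2n+1}.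
--
-- Pentagonal numbers.  With S_n = (p; p)_n ∑_{s ≤ n} (-1)^s p^{sn + s(s+1)/2} / (p; p)_s,
-- the difference S_n - S_{n-1} telescopes to (-1)^n (p^{(3n²-n)/2} + p^{(3n²+n)/2}),
-- while S_n ≡ (p; p)_n modulo p^n; take p = q².
--
-- The last equality is the limit of (q; q)_n (-q; q)_n = (q²; q²)_n.

module Submission where

open import Defs
open import Data.Nat.Base using (_+_; _*_; _^_)
open import Data.Product.Base using (_×_)
open import Relation.Binary.PropositionalEquality using (_≗_)

open import Algebra.Bundles using (CommutativeRing)
import Algebra.Construct.Pointwise as Pointwise
import Algebra.Solver.Ring as RingSolver
open import Algebra.Solver.Ring.AlmostCommutativeRing
  using (fromCommutativeRing; _-Raw-AlmostCommutative⟶_)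
open import Data.Fin.Base using (Fin; toℕ)
open import Data.Fin.Properties using (toℕ<n)
open import Data.Integer.Base as ℤ using (ℤ; +_; -[1+_]; 0ℤ; 1ℤ; -1ℤ; ∣_∣)
import Data.Integer.Properties as ℤ
import Data.Integer.Tactic.RingSolver as ℤ-Solver
import Data.Maybe.Base as Maybe
open import Data.Nat.Base as ℕ using (ℕ; zero; suc; _∸_)
import Data.Nat.Properties as ℕ
import Data.Nat.Tactic.RingSolver as ℕ-Solver
open import Data.Product.Base using (_,_; proj₁; proj₂)
open import Function.Base using (_∘_)
open import Level using (0ℓ)
open import Relation.Binary.Bundles using (Setoid)
open import Relation.Binary.PropositionalEquality as ≡ using (_≡_; cong; cong₂)
import Relation.Binary.Reasoning.Setoid as SetoidReasoning
open import Relation.Nullary.Decidable using (dec⇒maybe)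

-- Formal power series as a commutative ring.

*ₛ-cong : ∀ {f f′ g g′} → f ≗ f′ → g ≗ g′ → f *ₛ g ≗ f′ *ₛ g′
*ₛ-cong f≗f′ g≗g′ n =
  sum-cong-≗ λ (i : Fin (suc n)) → cong₂ ℤ._*_ (f≗f′ (toℕ i)) (g≗g′ (n ∸ toℕ i))

*ₛ-congˡ : ∀ f {g h} → g ≗ h → f *ₛ g ≗ f *ₛ h
*ₛ-congˡ f = *ₛ-cong {f} (λ _ → ≡.refl)

*ₛ-congʳ : ∀ h {f g} → f ≗ g → f *ₛ h ≗ g *ₛ h
*ₛ-congʳ h f≗g = *ₛ-cong {g = h} f≗g (λ _ → ≡.refl)

*ₛ-distribʳ-+ₛ : ∀ h f g → (f +ₛ g) *ₛ h ≗ f *ₛ h +ₛ g *ₛ h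
*ₛ-distribʳ-+ₛ h f g zero = step (f 0) (g 0) (h 0)
  where
  step : ∀ a b c → (a ℤ.+ b) ℤ.* c ℤ.+ 0ℤ ≡ (a ℤ.* c ℤ.+ 0ℤ) ℤ.+ (b ℤ.* c ℤ.+ 0ℤ)
  step = ℤ-Solver.solve-∀
*ₛ-distribʳ-+ₛ h f g (suc n) = ≡.trans
  (cong (λ x → (f 0 ℤ.+ g 0) ℤ.* h (suc n) ℤ.+ x) (*ₛ-distribʳ-+ₛ h (f ∘ suc) (g ∘ suc) n))
  (step (f 0) (g 0) (h (suc n)) (((f ∘ suc) *ₛ h) n) (((g ∘ suc) *ₛ h) n))
  where
  step : ∀ a b c x y → (a ℤ.+ b) ℤ.* c ℤ.+ (x ℤ.+ y) ≡ (a ℤ.* c ℤ.+ x) ℤ.+ (b ℤ.* c ℤ.+ y)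
  step = ℤ-Solver.solve-∀

·-*ₛ : ∀ c f g → (c · f) *ₛ g ≗ c · (f *ₛ g)
·-*ₛ c f g zero = step c (f 0) (g 0)
  where
  step : ∀ c a b → c ℤ.* a ℤ.* b ℤ.+ 0ℤ ≡ c ℤ.* (a ℤ.* b ℤ.+ 0ℤ)
  step = ℤ-Solver.solve-∀
·-*ₛ c f g (suc n) = ≡.trans
  (cong (λ x → c ℤ.* f 0 ℤ.* g (suc n) ℤ.+ x) (·-*ₛ c (f ∘ suc) g n))
  (step c (f 0) (g (suc n)) (((f ∘ suc) *ₛ g) n))
  where
  step : ∀ c a b x → c ℤ.* a ℤ.* b ℤ.+ c ℤ.* x ≡ c ℤ.* (a ℤ.* b ℤ.+ x)
  step = ℤ-Solver.solve-∀

-- The Cauchy product unfolds only along its left factor, so the induction takes two steps at once: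
-- unfold `f`, swap and unfold `g`, and the remaining product of the two tails has index smaller by
-- two. Hence the two base cases.
*ₛ-comm : ∀ f g → f *ₛ g ≗ g *ₛ f
*ₛ-comm f g zero = cong (ℤ._+ 0ℤ) (ℤ.*-comm (f 0) (g 0))
*ₛ-comm f g (suc zero) = step (f 0) (f 1) (g 0) (g 1)
  where
  step : ∀ a a′ b b′ → a ℤ.* b′ ℤ.+ (a′ ℤ.* b ℤ.+ 0ℤ) ≡ b ℤ.* a′ ℤ.+ (b′ ℤ.* a ℤ.+ 0ℤ)
  step = ℤ-Solver.solve-∀
*ₛ-comm f g (suc (suc n)) = begin
  f 0 ℤ.* g (2 + n) ℤ.+ (f′ *ₛ g) (suc n)
    ≡⟨ cong (λ x → f 0 ℤ.* g (2 + n) ℤ.+ x) (*ₛ-comm f′ g (suc n)) ⟩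
  f 0 ℤ.* g (2 + n) ℤ.+ (g 0 ℤ.* f (2 + n) ℤ.+ (g′ *ₛ f′) n)
    ≡⟨ cong (λ x → f 0 ℤ.* g (2 + n) ℤ.+ (g 0 ℤ.* f (2 + n) ℤ.+ x)) (*ₛ-comm g′ f′ n) ⟩
  f 0 ℤ.* g (2 + n) ℤ.+ (g 0 ℤ.* f (2 + n) ℤ.+ (f′ *ₛ g′) n)
    ≡⟨ step (f 0 ℤ.* g (2 + n)) (g 0 ℤ.* f (2 + n)) ((f′ *ₛ g′) n) ⟩
  g 0 ℤ.* f (2 + n) ℤ.+ (f *ₛ g′) (suc n)
    ≡⟨ cong (λ x → g 0 ℤ.* f (2 + n) ℤ.+ x) (*ₛ-comm f g′ (suc n)) ⟩
  g 0 ℤ.* f (2 + n) ℤ.+ (g′ *ₛ f) (suc n) ∎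
  where
  open ≡.≡-Reasoning
  f′ = f ∘ suc
  g′ = g ∘ suc
  step : ∀ a b c → a ℤ.+ (b ℤ.+ c) ≡ b ℤ.+ (a ℤ.+ c)
  step = ℤ-Solver.solve-∀

-- The tail of `f *ₛ g` is `f 0 · g′ +ₛ f′ *ₛ g` by computation, so right distributivity and `·-*ₛ`
-- reduce the claim to the tail `f′`.
*ₛ-assoc : ∀ f g h → (f *ₛ g) *ₛ h ≗ f *ₛ (g *ₛ h)
*ₛ-assoc f g h zero = step (f 0) (g 0) (h 0)
  where
  step : ∀ a b c → (a ℤ.* b ℤ.+ 0ℤ) ℤ.* c ℤ.+ 0ℤ ≡ a ℤ.* (b ℤ.* c ℤ.+ 0ℤ) ℤ.+ 0ℤ
  step = ℤ-Solver.solve-∀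
*ₛ-assoc f g h (suc n) = begin
  (f 0 ℤ.* g 0 ℤ.+ 0ℤ) ℤ.* h (suc n) ℤ.+ ((f 0 · g′ +ₛ f′ *ₛ g) *ₛ h) n
    ≡⟨ cong (λ x → (f 0 ℤ.* g 0 ℤ.+ 0ℤ) ℤ.* h (suc n) ℤ.+ x)
            (≡.trans (*ₛ-distribʳ-+ₛ h (f 0 · g′) (f′ *ₛ g) n)
                     (cong₂ ℤ._+_ (·-*ₛ (f 0) g′ h n) (*ₛ-assoc f′ g h n))) ⟩
  (f 0 ℤ.* g 0 ℤ.+ 0ℤ) ℤ.* h (suc n) ℤ.+ (f 0 ℤ.* (g′ *ₛ h) n ℤ.+ (f′ *ₛ (g *ₛ h)) n)
    ≡⟨ step (f 0) (g 0) (h (suc n)) ((g′ *ₛ h) n) ((f′ *ₛ (g *ₛ h)) n) ⟩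
  f 0 ℤ.* (g *ₛ h) (suc n) ℤ.+ (f′ *ₛ (g *ₛ h)) n ∎
  where
  open ≡.≡-Reasoning
  f′ = f ∘ suc
  g′ = g ∘ suc
  step : ∀ a b c x y → (a ℤ.* b ℤ.+ 0ℤ) ℤ.* c ℤ.+ (a ℤ.* x ℤ.+ y) ≡ a ℤ.* (b ℤ.* c ℤ.+ x) ℤ.+ y
  step = ℤ-Solver.solve-∀

seriesRing : CommutativeRing 0ℓ 0ℓ
seriesRing = record
  { Carrier = Series
  ; _≈_     = _≗_
  ; _+_     = _+ₛ_
  ; _*_     = _*ₛ_
  ; -_      = -ₛ_
  ; 0#      = 0ₛ
  ; 1#      = 1ₛ
  ; isCommutativeRing = record
    { isRing = record
      { +-isAbelianGroup = Pointwise.isAbelianGroup ℕ ℤ.+-0-isAbelianGroup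
      ; *-cong           = *ₛ-cong
      ; *-assoc          = *ₛ-assoc
      ; *-identity       = (λ f n → ≡.trans (*ₛ-comm 1ₛ f n) (*ₛ-identityʳ f n)) , *ₛ-identityʳ
      ; distrib          = (λ f g h n → ≡.trans (*ₛ-comm f (g +ₛ h) n) (≡.trans
                              (*ₛ-distribʳ-+ₛ f g h n)
                              (cong₂ ℤ._+_ (*ₛ-comm g f n) (*ₛ-comm h f n))))
                         , *ₛ-distribʳ-+ₛ
      }
    ; *-comm = *ₛ-comm
    }
  }

open CommutativeRing seriesRing
  using (refl; sym; trans; setoid; +-cong; -‿cong; *-identityˡ; *-identityʳ; zeroʳ; distribˡ)

-- 0 and 1 are singled out so that the solver's constants are literally 0ₛ and 1ₛ.
constant : ℤ → Series
constant (+ 0) = 0ₛ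
constant (+ 1) = 1ₛ
constant c     = c · 1ₛ

constant-· : ∀ c → constant c ≗ c · 1ₛ
constant-· (+ 0)           n = ≡.sym (ℤ.*-zeroˡ (1ₛ n))
constant-· (+ 1)           n = ≡.sym (ℤ.*-identityˡ (1ₛ n))
constant-· (+ suc (suc _)) n = ≡.refl
constant-· -[1+ _ ]        n = ≡.refl

-- The solver has to test coefficients for equality, which is not decidable for series; the
-- coefficients are therefore integers, embedded as constant series.
constant-homomorphism :
  CommutativeRing.rawRing ℤ.+-*-commutativeRing -Raw-AlmostCommutative⟶ fromCommutativeRing seriesRing
constant-homomorphism = record
  { ⟦_⟧    = constant
  ; +-homo = λ a b n → ≡.trans (constant-· (a ℤ.+ b) n) (≡.trans (ℤ.*-distribʳ-+ (1ₛ n) a b)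
      (≡.sym (cong₂ ℤ._+_ (constant-· a n) (constant-· b n))))
  ; *-homo = λ a b → trans (constant-· (a ℤ.* b)) (trans (λ n → ℤ.*-assoc a b (1ₛ n)) (sym
      (trans (*ₛ-cong (constant-· a) (constant-· b)) (trans (·-*ₛ a 1ₛ (b · 1ₛ))
        (λ n → cong (a ℤ.*_) (*-identityˡ (b · 1ₛ) n))))))
  ; -‿homo = λ a n → ≡.trans (constant-· (ℤ.- a) n) (≡.trans (≡.sym (ℤ.neg-distribˡ-* a (1ₛ n)))
      (cong ℤ.-_ (≡.sym (constant-· a n))))
  ; 0-homo = refl
  ; 1-homo = refl
  }

module Solver = RingSolver _ _ constant-homomorphism
  (λ a b → Maybe.map (λ a≡b n → cong (λ c → constant c n) a≡b) (dec⇒maybe (a ℤ.≟ b)))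
open Solver using (solve; _:+_; _:*_; _:-_; :-_; _:=_; con)

-- Powers and signs.

^ₛ-+ : ∀ f m n → f ^ₛ (m + n) ≗ f ^ₛ m *ₛ f ^ₛ n
^ₛ-+ f zero    n = sym (*-identityˡ (f ^ₛ n))
^ₛ-+ f (suc m) n = trans (*ₛ-congˡ f (^ₛ-+ f m n)) (sym (*ₛ-assoc f (f ^ₛ m) (f ^ₛ n)))

^ₛ-suc : ∀ f n → f ^ₛ suc n ≗ f ^ₛ n *ₛ f
^ₛ-suc f n = *ₛ-comm f (f ^ₛ n)

^ₛ-≡ : ∀ f {m n} → m ≡ n → f ^ₛ m ≗ f ^ₛ n
^ₛ-≡ f ≡.refl = refl

^ₛ-* : ∀ f m n → (f ^ₛ m) ^ₛ n ≗ f ^ₛ (n * m)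
^ₛ-* f m zero    = refl
^ₛ-* f m (suc n) = trans (*ₛ-congˡ (f ^ₛ m) (^ₛ-* f m n)) (sym (^ₛ-+ f m (n * m)))

-- Turns the integer sign of the bilateral series into a power inside the ring of series, where the
-- ring solver can handle it.
-1^-· : ∀ n f → (-1ℤ ℤ.^ n) · f ≗ (-ₛ 1ₛ) ^ₛ n *ₛ f
-1^-· zero    f = trans (λ i → ℤ.*-identityˡ (f i)) (sym (*-identityˡ f))
-1^-· (suc n) f = trans (λ i → ℤ.*-assoc -1ℤ (-1ℤ ℤ.^ n) (f i))
  (trans (λ i → ℤ.-1*i≡-i (((-1ℤ ℤ.^ n) · f) i))
  (trans (-‿cong (-1^-· n f))
    (solve 2 (λ a b → :- (a :* b) := (:- con 1ℤ) :* a :* b) refl ((-ₛ 1ₛ) ^ₛ n) f)))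

-- Congruence modulo powers of q, and limits.

infix 4 _≈[_]_

-- Congruence modulo q^n. Every limit below is handled by replacing it with its n-th approximant
-- modulo q^n, for each n.
_≈[_]_ : Series → ℕ → Series → Set
f ≈[ n ] g = ∀ i → i ℕ.< n → f i ≡ g i

exact : ∀ {f g n} → f ≗ g → f ≈[ n ] g
exact f≗g i _ = f≗g i

≈[]-setoid : ℕ → Setoid 0ℓ 0ℓ
≈[]-setoid n = record
  { _≈_           = _≈[ n ]_
  ; isEquivalence = record
    { refl  = λ _ _ → ≡.refl
    ; sym   = λ p i i<n → ≡.sym (p i i<n)
    ; trans = λ p r i i<n → ≡.trans (p i i<n) (r i i<n)
    }
  }

module ≈[]-Reasoning (n : ℕ) = SetoidReasoning (≈[]-setoid n)
module ≗-Reasoning = SetoidReasoning setoid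

≈[]-≤ : ∀ {m n f g} → m ℕ.≤ n → f ≈[ n ] g → f ≈[ m ] g
≈[]-≤ m≤n p i i<m = p i (ℕ.<-≤-trans i<m m≤n)

≈[]⇒≗ : ∀ {f g} → (∀ n → f ≈[ n ] g) → f ≗ g
≈[]⇒≗ p i = p (suc i) i (ℕ.n<1+n i)

+ₛ-≈[] : ∀ {n f f′ g g′} → f ≈[ n ] f′ → g ≈[ n ] g′ → f +ₛ g ≈[ n ] f′ +ₛ g′
+ₛ-≈[] p r i i<n = cong₂ ℤ._+_ (p i i<n) (r i i<n)

*ₛ-≈[] : ∀ {n f f′ g g′} → f ≈[ n ] f′ → g ≈[ n ] g′ → f *ₛ g ≈[ n ] f′ *ₛ g′
*ₛ-≈[] p r i i<n = sum-cong-≗ λ (j : Fin (suc i)) → cong₂ ℤ._*_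
  (p (toℕ j) (ℕ.≤-<-trans (ℕ.≤-pred (toℕ<n j)) i<n))
  (r (i ∸ toℕ j) (ℕ.≤-<-trans (ℕ.m∸n≤m i (toℕ j)) i<n))

+ₛ-order : ∀ {n} f {g} → Order≥ n g → f +ₛ g ≈[ n ] f
+ₛ-order f o i i<n = ≡.trans (cong (λ x → f i ℤ.+ x) (o i i<n)) (ℤ.+-identityʳ (f i))

-- The hypothesis on `c` says that coefficient N is settled from stage N + 1 on. Proofs built by
-- `stabilises⇒converges` satisfy it by computation.
lim-≈[] : ∀ {s} (c : Converges s) → (∀ N → proj₁ (c N) ≡ suc N) → ∀ n → lim s c ≈[ n ] s n
lim-≈[] c rate n i i<n = ≡.sym (proj₂ (c i) n (≡.subst (ℕ._≤ n) (≡.sym (rate i)) i<n))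

recip-unique : ∀ f g → f 0 ≡ 1ℤ → f *ₛ g ≗ 1ₛ → g ≗ recip f
recip-unique f g f₀ fg≗1 = begin
  g                  ≈⟨ *-identityʳ g ⟨
  g *ₛ 1ₛ            ≈⟨ *ₛ-congˡ g (recip-inverseʳ f f₀) ⟨
  g *ₛ (f *ₛ recip f) ≈⟨ solve 3 (λ a b c → a :* (b :* c) := b :* a :* c) refl g f (recip f) ⟩
  f *ₛ g *ₛ recip f  ≈⟨ *ₛ-congʳ (recip f) fg≗1 ⟩
  1ₛ *ₛ recip f      ≈⟨ *-identityˡ (recip f) ⟩
  recip f ∎
  where open ≗-Reasoning

-- Triangular numbers.

triangular : ℕ → ℕ
triangular zero    = 0
triangular (suc n) = suc n + triangular n

triangular-double : ∀ n → 2 * triangular n ≡ n * suc n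
triangular-double zero    = ≡.refl
triangular-double (suc n) = ≡.trans (ℕ.*-distribˡ-+ 2 (suc n) (triangular n))
  (≡.trans (cong (λ x → 2 * suc n + x) (triangular-double n)) (step n))
  where
  step : ∀ n → 2 * (1 + n) + n * (1 + n) ≡ (1 + n) * (2 + n)
  step = ℕ-Solver.solve-∀

triangular-even : ∀ n → triangular (2 * n) ≡ 2 * n ^ 2 + n
triangular-even n = ℕ.*-cancelˡ-≡ _ _ 2 (≡.trans (triangular-double (2 * n)) (step n))
  where
  step : ∀ n → 2 * n * (1 + 2 * n) ≡ 2 * (2 * (n * (n * 1)) + n)
  step = ℕ-Solver.solve-∀

-- Euler's series for (-p; p)_∞, for any base p divisible by q.

module _ (p : Series) (p₀ : p 0 ≡ 0ℤ) where

  private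
    G r : ℕ → Series
    G n = ⟨ p ⨾ p ⟩[ n ]
    r n = recip (G n)

  ⟨⨾⟩-recip : ∀ n → G n *ₛ r n ≗ 1ₛ
  ⟨⨾⟩-recip n = recip-inverseʳ (G n) (⟨⨾⟩-constant p p n p₀)

  recip-⟨⨾⟩-zero : r 0 ≗ 1ₛ
  recip-⟨⨾⟩-zero = trans (sym (*-identityˡ (r 0))) (⟨⨾⟩-recip 0)

  -- `G (suc n)` is `G n` times the factor shown, so that factor times `r (suc n)` is an inverse of
  -- `G n`, and inverses are unique.
  recip-⟨⨾⟩-suc : ∀ n → r n ≗ (1ₛ -ₛ p ^ₛ n *ₛ p) *ₛ r (suc n)
  recip-⟨⨾⟩-suc n = sym (recip-unique (G n) (c *ₛ r (suc n)) (⟨⨾⟩-constant p p n p₀)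
    (trans (sym (*ₛ-assoc (G n) c (r (suc n)))) (⟨⨾⟩-recip (suc n))))
    where c = 1ₛ -ₛ p ^ₛ n *ₛ p

  order-p^ : ∀ {m n} f → m ℕ.≤ n → Order≥ m (p ^ₛ n *ₛ f)
  order-p^ {n = n} f m≤n = order-*ₛ (p ^ₛ n) f (order-≤ (p ^ₛ n) m≤n (order-^ₛ p p₀ n))

  -- Factor by factor this is (1 - p^{n+1})(1 + p^{n+1}) = 1 - p^{2n+2}.
  ⟨⨾⟩-square : ∀ n → ⟨ p ⨾ p ⟩[ n ] *ₛ ⟨ -ₛ p ⨾ p ⟩[ n ] ≗ ⟨ p ^ₛ 2 ⨾ p ^ₛ 2 ⟩[ n ]
  ⟨⨾⟩-square zero    = *-identityʳ 1ₛ
  ⟨⨾⟩-square (suc n) = begin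
    (a *ₛ (1ₛ -ₛ x *ₛ p)) *ₛ (b *ₛ (1ₛ -ₛ x *ₛ -ₛ p))
      ≈⟨ solve 4 (λ a b x p →
           (a :* (con 1ℤ :- x :* p)) :* (b :* (con 1ℤ :- x :* (:- p)))
             := (a :* b) :* (con 1ℤ :- (x :* x) :* (p :* (p :* con 1ℤ)))) refl a b x p ⟩
    (a *ₛ b) *ₛ (1ₛ -ₛ (x *ₛ x) *ₛ p ^ₛ 2)
      ≈⟨ *ₛ-cong (⟨⨾⟩-square n) (+-cong (refl {1ₛ}) (-‿cong (*ₛ-congʳ (p ^ₛ 2) x²≗))) ⟩
    ⟨ p ^ₛ 2 ⨾ p ^ₛ 2 ⟩[ n ] *ₛ (1ₛ -ₛ (p ^ₛ 2) ^ₛ n *ₛ p ^ₛ 2) ∎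
    where
    open ≗-Reasoning
    a = ⟨ p ⨾ p ⟩[ n ]
    b = ⟨ -ₛ p ⨾ p ⟩[ n ]
    x = p ^ₛ n
    n+n≡n*2 : ∀ n → n + n ≡ n * 2
    n+n≡n*2 = ℕ-Solver.solve-∀
    x²≗ : x *ₛ x ≗ (p ^ₛ 2) ^ₛ n
    x²≗ = trans (sym (^ₛ-+ p n n)) (trans (^ₛ-≡ p (n+n≡n*2 n)) (sym (^ₛ-* p 2 n)))

  -- Euler's series for ∏_{i > j} (1 + pⁱ).
  eulerTerm : ℕ → ℕ → Series
  eulerTerm j m = p ^ₛ (triangular m + j * m) *ₛ r m

  euler : ℕ → ℕ → Series
  euler j = partialSum (eulerTerm j)

  eulerTerm-zero : ∀ j → eulerTerm j 0 ≗ 1ₛ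
  eulerTerm-zero j = trans (*ₛ-cong (^ₛ-≡ p (ℕ.*-zeroʳ j)) recip-⟨⨾⟩-zero) (*-identityʳ 1ₛ)

  euler-one : ∀ j → euler j 1 ≗ 1ₛ
  euler-one j n = ≡.trans (ℤ.+-identityˡ _) (eulerTerm-zero j n)

  -- With z = p^{m+1}, split the power as xy = xyz + xy(1 - z). The first part raises j to j + 1 in
  -- the exponent; in the second, 1 - z cancels the last factor of the denominator and lowers m + 1
  -- to m.
  eulerTerm-suc : ∀ j m →
    eulerTerm j (suc m) ≗ eulerTerm (suc j) (suc m) +ₛ p ^ₛ suc j *ₛ eulerTerm (suc j) m
  eulerTerm-suc j m = begin
    p ^ₛ (triangular (suc m) + j * suc m) *ₛ r (suc m)
      ≈⟨ *ₛ-congʳ (r (suc m)) xy ⟩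
    x *ₛ y *ₛ r (suc m)
      ≈⟨ solve 4 (λ x y z r → x :* y :* r := x :* y :* z :* r :+ y :* (x :* ((con 1ℤ :- z) :* r)))
           refl x y z (r (suc m)) ⟩
    x *ₛ y *ₛ z *ₛ r (suc m) +ₛ y *ₛ (x *ₛ ((1ₛ -ₛ z) *ₛ r (suc m)))
      ≈⟨ +-cong (*ₛ-congʳ (r (suc m)) xyz) (*ₛ-congˡ y (*ₛ-congˡ x (recip-⟨⨾⟩-suc m))) ⟨
    eulerTerm (suc j) (suc m) +ₛ p ^ₛ suc j *ₛ eulerTerm (suc j) m ∎
    where
    open ≗-Reasoning
    x = p ^ₛ (triangular m + suc j * m)
    y = p ^ₛ suc j
    z = p ^ₛ m *ₛ p
    exponent : ∀ t j m → 1 + m + t + j * (1 + m) ≡ t + (1 + j) * m + (1 + j)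
    exponent = ℕ-Solver.solve-∀
    exponent′ : ∀ t j m → 1 + m + t + (1 + j) * (1 + m) ≡ t + (1 + j) * m + (1 + j) + (1 + m)
    exponent′ = ℕ-Solver.solve-∀
    xy : p ^ₛ (triangular (suc m) + j * suc m) ≗ x *ₛ y
    xy = trans (^ₛ-≡ p (exponent (triangular m) j m)) (^ₛ-+ p (triangular m + suc j * m) (suc j))
    xyz : p ^ₛ (triangular (suc m) + suc j * suc m) ≗ x *ₛ y *ₛ z
    xyz = trans (^ₛ-≡ p (exponent′ (triangular m) j m))
      (trans (^ₛ-+ p (triangular m + suc j * m + suc j) (suc m))
        (*ₛ-cong (^ₛ-+ p (triangular m + suc j * m) (suc j)) (^ₛ-suc p m)))

  -- Summing `eulerTerm-suc` shifts the index in the second sum, which therefore has one term fewer.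
  -- The terms of index 0 equal 1 on both sides.
  euler-suc : ∀ j m → euler j (suc m) ≗ euler (suc j) (suc m) +ₛ p ^ₛ suc j *ₛ euler (suc j) m
  euler-suc j zero    = trans (euler-one j) (sym (begin
    euler (suc j) 1 +ₛ p ^ₛ suc j *ₛ 0ₛ ≈⟨ +-cong (euler-one (suc j)) (zeroʳ (p ^ₛ suc j)) ⟩
    1ₛ +ₛ 0ₛ                            ≈⟨ (λ n → ℤ.+-identityʳ (1ₛ n)) ⟩
    1ₛ                                  ∎))
    where open ≗-Reasoning
  euler-suc j (suc m) = trans (+-cong (euler-suc j m) (eulerTerm-suc j m))
    (solve 5 (λ e y f t u → (e :+ y :* f) :+ (t :+ y :* u) := (e :+ t) :+ y :* (f :+ u)) refl
      (euler (suc j) (suc m)) (p ^ₛ suc j) (euler (suc j) m)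
      (eulerTerm (suc j) (suc m)) (eulerTerm (suc j) m))

  -- The m-th term carries a power of p with exponent at least m, so it vanishes modulo q^m.
  euler-last : ∀ j m → euler j (suc m) ≈[ m ] euler j m
  euler-last j m = +ₛ-order (euler j m) (order-p^ (r m) (bound j m))
    where
    bound : ∀ j m → m ℕ.≤ triangular m + j * m
    bound j zero    = ℕ.z≤n
    bound j (suc m) = ℕ.≤-trans (ℕ.m≤m+n (suc m) (triangular m)) (ℕ.m≤m+n _ _)

  -- Discarding the last terms modulo q^m gives both sums in `euler-suc` the same length, so a
  -- common factor comes out.
  euler-factor : ∀ j m → euler j m ≈[ m ] (1ₛ -ₛ p ^ₛ j *ₛ -ₛ p) *ₛ euler (suc j) m
  euler-factor j m = begin
    euler j m
      ≈⟨ euler-last j m ⟨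
    euler j (suc m)
      ≈⟨ exact (euler-suc j m) ⟩
    euler (suc j) (suc m) +ₛ p ^ₛ suc j *ₛ e
      ≈⟨ +ₛ-≈[] (euler-last (suc j) m) (exact (refl {p ^ₛ suc j *ₛ e})) ⟩
    e +ₛ p ^ₛ suc j *ₛ e
      ≈⟨ exact (solve 3 (λ e p x → e :+ (p :* x) :* e := (con 1ℤ :- x :* (:- p)) :* e)
                  refl e p (p ^ₛ j)) ⟩
    (1ₛ -ₛ p ^ₛ j *ₛ -ₛ p) *ₛ e ∎
    where
    open ≈[]-Reasoning m
    e = euler (suc j) m

  euler-product : ∀ k m → euler 0 m ≈[ m ] ⟨ -ₛ p ⨾ p ⟩[ k ] *ₛ euler k m
  euler-product zero    m = exact (sym (*-identityˡ (euler 0 m)))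
  euler-product (suc k) m = begin
    euler 0 m                                     ≈⟨ euler-product k m ⟩
    g *ₛ euler k m                                ≈⟨ *ₛ-≈[] (exact (refl {g})) (euler-factor k m) ⟩
    g *ₛ (c *ₛ euler (suc k) m)                   ≈⟨ exact (*ₛ-assoc g c (euler (suc k) m)) ⟨
    g *ₛ c *ₛ euler (suc k) m                     ∎
    where
    open ≈[]-Reasoning m
    g = ⟨ -ₛ p ⨾ p ⟩[ k ]
    c = 1ₛ -ₛ p ^ₛ k *ₛ -ₛ p

  -- Every term after the first contains p^{km} with m at least 1, hence is divisible by q^k.
  euler-one-mod : ∀ k m → euler k (suc m) ≈[ k ] 1ₛ
  euler-one-mod k zero    = exact (euler-one k)
  euler-one-mod k (suc m) = begin
    euler k (suc m) +ₛ eulerTerm k (suc m)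
      ≈⟨ +ₛ-order (euler k (suc m)) (order-p^ (r (suc m))
           (ℕ.m≤n⇒m≤o+n (triangular (suc m)) (ℕ.m≤m*n k (suc m)))) ⟩
    euler k (suc m)
      ≈⟨ euler-one-mod k m ⟩
    1ₛ ∎
    where open ≈[]-Reasoning k

  -- Taking as many factors as the modulus makes the leftover series in `euler-product` congruent to
  -- 1.
  euler-≈[] : ∀ m → euler 0 m ≈[ m ] ⟨ -ₛ p ⨾ p ⟩[ m ]
  -- The empty sum is 0 and the empty product is 1, but modulo q^0 nothing is claimed.
  euler-≈[] zero    _ ()
  euler-≈[] (suc m) = begin
    euler 0 (suc m)             ≈⟨ euler-product (suc m) (suc m) ⟩
    g *ₛ euler (suc m) (suc m)  ≈⟨ *ₛ-≈[] (exact (refl {g})) (euler-one-mod (suc m) m) ⟩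
    g *ₛ 1ₛ                     ≈⟨ exact (*-identityʳ g) ⟩
    g                           ∎
    where
    open ≈[]-Reasoning (suc m)
    g = ⟨ -ₛ p ⨾ p ⟩[ suc m ]

  -- With z = p^{2n+1}, write 1 = (1 - z) + z. The factor 1 - z cancels against the denominator and
  -- leaves the even term; z turns the exponent `triangular (2 * n)` into the next triangular
  -- number.
  evenTerm : ∀ n →
    p ^ₛ (2 * n ^ 2 + n) /ₛ G (2 * n + 1) ≗ eulerTerm 0 (2 * n) +ₛ eulerTerm 0 (suc (2 * n))
  evenTerm n = begin
    p ^ₛ (2 * n ^ 2 + n) *ₛ r (2 * n + 1)
      ≈⟨ *ₛ-cong (^ₛ-≡ p (≡.sym (≡.trans (ℕ.+-identityʳ _) (triangular-even n))))
           (λ i → cong (λ k → r k i) (ℕ.+-comm (2 * n) 1)) ⟩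
    x *ₛ r′
      ≈⟨ solve 3 (λ x z r → x :* r := x :* ((con 1ℤ :- z) :* r) :+ x :* z :* r) refl x z r′ ⟩
    x *ₛ ((1ₛ -ₛ z) *ₛ r′) +ₛ x *ₛ z *ₛ r′
      ≈⟨ +-cong (*ₛ-congˡ x (recip-⟨⨾⟩-suc m)) (*ₛ-congʳ r′ xz) ⟨
    eulerTerm 0 m +ₛ eulerTerm 0 (suc m) ∎
    where
    open ≗-Reasoning
    m = 2 * n
    r′ = r (suc m)
    x = p ^ₛ (triangular m + 0)
    z = p ^ₛ m *ₛ p
    exponent : ∀ m t → suc m + t + 0 ≡ t + 0 + suc m
    exponent m t = ≡.trans (ℕ.+-assoc (suc m) t 0) (ℕ.+-comm (suc m) (t + 0))
    xz : p ^ₛ (triangular (suc m) + 0) ≗ x *ₛ z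
    xz = trans (^ₛ-≡ p (exponent m (triangular m)))
      (trans (^ₛ-+ p (triangular m + 0) (suc m)) (*ₛ-congˡ x (^ₛ-suc p m)))

  partialSum-evenTerm : ∀ n →
    partialSum (λ n → p ^ₛ (2 * n ^ 2 + n) /ₛ G (2 * n + 1)) n ≗ euler 0 (2 * n)
  partialSum-evenTerm zero    = refl
  partialSum-evenTerm (suc n) = begin
    partialSum (λ n → p ^ₛ (2 * n ^ 2 + n) /ₛ G (2 * n + 1)) n +ₛ (p ^ₛ (2 * n ^ 2 + n) /ₛ G (2 * n + 1))
      ≈⟨ +-cong (partialSum-evenTerm n) (evenTerm n) ⟩
    euler 0 (2 * n) +ₛ (eulerTerm 0 (2 * n) +ₛ eulerTerm 0 (suc (2 * n)))
      ≈⟨ (λ i → ℤ.+-assoc (euler 0 (2 * n) i) (eulerTerm 0 (2 * n) i) (eulerTerm 0 (suc (2 * n)) i)) ⟨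
    euler 0 (suc (suc (2 * n)))
      ≈⟨ (λ i → cong (λ k → euler 0 k i) (≡.sym (ℕ.*-suc 2 n))) ⟩
    euler 0 (2 * suc n) ∎
    where open ≗-Reasoning

-- Shanks's finite pentagonal number theorem.

module _ (p : Series) (p₀ : p 0 ≡ 0ℤ) where

  private
    G r σ : ℕ → Series
    G n = ⟨ p ⨾ p ⟩[ n ]
    r n = recip (G n)
    σ n = (-ₛ 1ₛ) ^ₛ n

  -- Shanks's finite form of the pentagonal number theorem: (p; p)ₙ times the
  -- sum of shanksTerm n s over s ≤ n is the bilateral sum over |k| ≤ n.
  shanksTerm : ℕ → ℕ → Series
  shanksTerm n s = p ^ₛ (s * n + triangular s) *ₛ (σ s *ₛ r s)

  shanks : ℕ → ℕ → Series
  shanks n = partialSum (shanksTerm n)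

  shanks-one : ∀ n → shanks n 1 ≗ 1ₛ
  shanks-one n = trans
    (solve 1 (λ r → con 0ℤ :+ con 1ℤ :* (con 1ℤ :* r) := r) refl (r 0))
    (recip-⟨⨾⟩-zero p p₀)

  -- The last summand is the boundary term of a telescoping sum over s. In the step from t to t + 1
  -- put y = p^{t+1} and z = p^{n+1}: the old boundary term contributes x(1 - y), the new term on
  -- the left (1 - z)xy, and together they give x - xyz. Here x yields the next term of `shanks n`,
  -- and -xyz the next boundary term.
  shanks-telescope : ∀ n t →
    G (suc n) *ₛ shanks (suc n) (suc t)
      ≗ G n *ₛ shanks n (suc t)
        +ₛ G n *ₛ (p ^ₛ (suc t * suc n + triangular t) *ₛ (σ (suc t) *ₛ r t))
  shanks-telescope n zero    = begin
    (g *ₛ (1ₛ -ₛ p ^ₛ n *ₛ p)) *ₛ s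
      ≈⟨ solve 4 (λ g x p r →
           (g :* (con 1ℤ :- x :* p)) :* (con 0ℤ :+ con 1ℤ :* (con 1ℤ :* r))
             := g :* (con 0ℤ :+ con 1ℤ :* (con 1ℤ :* r))
                :+ g :* ((p :* x) :* ((:- con 1ℤ) :* con 1ℤ :* r)))
           refl g (p ^ₛ n) p (r 0) ⟩
    g *ₛ s +ₛ g *ₛ (p ^ₛ suc n *ₛ (σ 1 *ₛ r 0))
      ≈⟨ +-cong (refl {g *ₛ s}) (*ₛ-congˡ g (*ₛ-congʳ (σ 1 *ₛ r 0) (^ₛ-≡ p (exponent n)))) ⟩
    g *ₛ s +ₛ g *ₛ (p ^ₛ (1 * suc n + 0) *ₛ (σ 1 *ₛ r 0)) ∎
    where
    open ≗-Reasoning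
    g = G n
    s = shanks n 1
    exponent : ∀ n → 1 + n ≡ 1 * (1 + n) + 0
    exponent = ℕ-Solver.solve-∀
  shanks-telescope n (suc t) = begin
    G (suc n) *ₛ (shanks (suc n) (suc t) +ₛ shanksTerm (suc n) (suc t))
      ≈⟨ distribˡ (G (suc n)) (shanks (suc n) (suc t)) (shanksTerm (suc n) (suc t)) ⟩
    G (suc n) *ₛ shanks (suc n) (suc t) +ₛ G (suc n) *ₛ shanksTerm (suc n) (suc t)
      ≈⟨ +-cong (shanks-telescope n t) (*ₛ-congˡ (G (suc n)) (*ₛ-congʳ (σ (suc t) *ₛ r′) xy)) ⟩
    (g *ₛ s +ₛ g *ₛ (p ^ₛ (suc t * suc n + triangular t) *ₛ (σ (suc t) *ₛ r t)))
      +ₛ (g *ₛ (1ₛ -ₛ z)) *ₛ ((x *ₛ y) *ₛ (σ (suc t) *ₛ r′))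
      ≈⟨ +-cong (+-cong (refl {g *ₛ s}) (*ₛ-congˡ g (*ₛ-cong x≗ (*ₛ-congˡ (σ (suc t)) (recip-⟨⨾⟩-suc p p₀ t)))))
           (refl {(g *ₛ (1ₛ -ₛ z)) *ₛ ((x *ₛ y) *ₛ (σ (suc t) *ₛ r′))}) ⟩
    (g *ₛ s +ₛ g *ₛ (x *ₛ (σ (suc t) *ₛ ((1ₛ -ₛ y) *ₛ r′))))
      +ₛ (g *ₛ (1ₛ -ₛ z)) *ₛ ((x *ₛ y) *ₛ (σ (suc t) *ₛ r′))
      ≈⟨ solve 7 (λ g s x y z σ r →
           (g :* s :+ g :* (x :* (σ :* ((con 1ℤ :- y) :* r))))
             :+ (g :* (con 1ℤ :- z)) :* ((x :* y) :* (σ :* r))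
           := g :* (s :+ x :* (σ :* r)) :+ g :* ((x :* y :* z) :* ((:- con 1ℤ) :* σ :* r)))
           refl g s x y z (σ (suc t)) r′ ⟩
    g *ₛ (s +ₛ x *ₛ (σ (suc t) *ₛ r′)) +ₛ g *ₛ ((x *ₛ y *ₛ z) *ₛ (σ (suc (suc t)) *ₛ r′))
      ≈⟨ +-cong (refl {g *ₛ shanks n (suc (suc t))})
           (*ₛ-congˡ g (*ₛ-congʳ (σ (suc (suc t)) *ₛ r′) xyz)) ⟨
    g *ₛ shanks n (suc (suc t))
      +ₛ g *ₛ (p ^ₛ (suc (suc t) * suc n + triangular (suc t)) *ₛ (σ (suc (suc t)) *ₛ r′)) ∎
    where
    open ≗-Reasoning
    g = G n
    s = shanks n (suc t)
    r′ = r (suc t)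
    e = suc t * n + triangular (suc t)
    x = p ^ₛ e
    y = p ^ₛ t *ₛ p
    z = p ^ₛ n *ₛ p
    exponent : ∀ t n u → (1 + t) * (1 + n) + u ≡ (1 + t) * n + (1 + t + u)
    exponent = ℕ-Solver.solve-∀
    exponent′ : ∀ t n u → (1 + t) * (1 + n) + u ≡ (1 + t) * n + u + (1 + t)
    exponent′ = ℕ-Solver.solve-∀
    exponent″ : ∀ t n u → (2 + t) * (1 + n) + u ≡ (1 + t) * n + u + (1 + t) + (1 + n)
    exponent″ = ℕ-Solver.solve-∀
    x≗ : p ^ₛ (suc t * suc n + triangular t) ≗ x
    x≗ = ^ₛ-≡ p (exponent t n (triangular t))
    xy : p ^ₛ (suc t * suc n + triangular (suc t)) ≗ x *ₛ y
    xy = trans (^ₛ-≡ p (exponent′ t n (triangular (suc t))))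
      (trans (^ₛ-+ p e (suc t)) (*ₛ-congˡ x (^ₛ-suc p t)))
    xyz : p ^ₛ (suc (suc t) * suc n + triangular (suc t)) ≗ x *ₛ y *ₛ z
    xyz = trans (^ₛ-≡ p (exponent″ t n (triangular (suc t))))
      (trans (^ₛ-+ p (e + suc t) (suc n))
        (*ₛ-cong (trans (^ₛ-+ p e (suc t)) (*ₛ-congˡ x (^ₛ-suc p t))) (^ₛ-suc p n)))

  -- The telescoped identity at t = n leaves its boundary term, and the left side has one more term,
  -- s = n + 1. In both, `G m` meets its reciprocal, so only two signed powers of p survive. With N
  -- = n + 1 their exponents are (3N² - N)/2 and (3N² + N)/2.
  shanks-suc : ∀ n →
    G (suc n) *ₛ shanks (suc n) (suc (suc n))
      ≗ G n *ₛ shanks n (suc n)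
        +ₛ (σ (suc n) *ₛ p ^ₛ (suc n * suc n + triangular n)
            +ₛ σ (suc n) *ₛ p ^ₛ (suc n * suc n + triangular (suc n)))
  shanks-suc n = begin
    G (suc n) *ₛ (shanks (suc n) (suc n) +ₛ y *ₛ (s *ₛ r (suc n)))
      ≈⟨ distribˡ (G (suc n)) (shanks (suc n) (suc n)) (y *ₛ (s *ₛ r (suc n))) ⟩
    G (suc n) *ₛ shanks (suc n) (suc n) +ₛ G (suc n) *ₛ (y *ₛ (s *ₛ r (suc n)))
      ≈⟨ +-cong (shanks-telescope n n) (cancel (suc n) y) ⟩
    (G n *ₛ shanks n (suc n) +ₛ G n *ₛ (x *ₛ (s *ₛ r n))) +ₛ s *ₛ y
      ≈⟨ +-cong (+-cong (refl {G n *ₛ shanks n (suc n)}) (cancel n x)) (refl {s *ₛ y}) ⟩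
    (G n *ₛ shanks n (suc n) +ₛ s *ₛ x) +ₛ s *ₛ y
      ≈⟨ (λ i → ℤ.+-assoc ((G n *ₛ shanks n (suc n)) i) ((s *ₛ x) i) ((s *ₛ y) i)) ⟩
    G n *ₛ shanks n (suc n) +ₛ (s *ₛ x +ₛ s *ₛ y) ∎
    where
    open ≗-Reasoning
    s = σ (suc n)
    x = p ^ₛ (suc n * suc n + triangular n)
    y = p ^ₛ (suc n * suc n + triangular (suc n))
    cancel : ∀ m f → G m *ₛ (f *ₛ (s *ₛ r m)) ≗ s *ₛ f
    cancel m f = begin
      G m *ₛ (f *ₛ (s *ₛ r m))
        ≈⟨ solve 4 (λ g f s r → g :* (f :* (s :* r)) := s :* f :* (g :* r)) refl (G m) f s (r m) ⟩
      s *ₛ f *ₛ (G m *ₛ r m)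
        ≈⟨ *ₛ-congˡ (s *ₛ f) (⟨⨾⟩-recip p p₀ m) ⟩
      s *ₛ f *ₛ 1ₛ
        ≈⟨ *-identityʳ (s *ₛ f) ⟩
      s *ₛ f ∎

  -- Every term with s at least 1 contains p^{sn}, which is divisible by q^n.
  shanks-one-mod : ∀ n m → shanks n (suc m) ≈[ n ] 1ₛ
  shanks-one-mod n zero    = exact (shanks-one n)
  shanks-one-mod n (suc m) = begin
    shanks n (suc m) +ₛ shanksTerm n (suc m)
      ≈⟨ +ₛ-order (shanks n (suc m)) (order-p^ p p₀ (σ (suc m) *ₛ r (suc m))
           (ℕ.≤-trans (ℕ.m≤n*m n (suc m)) (ℕ.m≤m+n (suc m * n) (triangular (suc m))))) ⟩
    shanks n (suc m)
      ≈⟨ shanks-one-mod n m ⟩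
    1ₛ ∎
    where open ≈[]-Reasoning n

  shanks-≈[] : ∀ n → G n *ₛ shanks n (suc n) ≈[ n ] G n
  shanks-≈[] n = begin
    G n *ₛ shanks n (suc n) ≈⟨ *ₛ-≈[] (exact (refl {G n})) (shanks-one-mod n n) ⟩
    G n *ₛ 1ₛ               ≈⟨ exact (*-identityʳ (G n)) ⟩
    G n                     ∎
    where open ≈[]-Reasoning n

-- The bilateral series in terms of the Shanks sums with p = q².

-- The factor 2 comes from p = q². To avoid truncated subtraction, `double` adds k to both sides and
-- is proved in ℕ; k is subtracted again in ℤ.
3k²-k-+suc : ∀ n → 2 * (suc n * suc n + triangular n) ≡ 3k²-k (+ suc n)
3k²-k-+suc n = ℤ.+-injective (≡.trans (≡.sym (cancel (+ (2 * (suc n * suc n + triangular n))) (+ suc n)))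
  (≡.trans (cong (ℤ._- + suc n) (≡.trans (≡.sym (ℤ.pos-+ (2 * (suc n * suc n + triangular n)) (suc n))) (≡.trans (cong +_ double)
    (≡.trans (ℤ.pos-* 3 (suc n * suc n)) (cong (+ 3 ℤ.*_) (ℤ.pos-* (suc n) (suc n)))))))
  (≡.sym (+3k²-k (+ suc n)))))
  where
  cancel : ∀ a b → a ℤ.+ b ℤ.- b ≡ a
  cancel = ℤ-Solver.solve-∀
  step : ∀ n → 2 * ((1 + n) * (1 + n)) + n * (1 + n) + (1 + n) ≡ 3 * ((1 + n) * (1 + n))
  step = ℕ-Solver.solve-∀
  double : 2 * (suc n * suc n + triangular n) + suc n ≡ 3 * (suc n * suc n)
  double = ≡.trans (cong (_+ suc n) (≡.trans (ℕ.*-distribˡ-+ 2 (suc n * suc n) (triangular n))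
    (cong (λ x → 2 * (suc n * suc n) + x) (triangular-double n)))) (step n)

3k²-k--suc : ∀ n → 2 * (suc n * suc n + triangular (suc n)) ≡ 3k²-k -[1+ n ]
3k²-k--suc n = ℤ.+-injective (≡.trans (cong +_ double) (≡.trans (ℤ.pos-+ (3 * (suc n * suc n)) (suc n))
    (≡.trans (cong (ℤ._+ + suc n) (≡.trans (ℤ.pos-* 3 (suc n * suc n)) (cong (+ 3 ℤ.*_) (ℤ.pos-* (suc n) (suc n)))))
  (≡.sym (+3k²-k -[1+ n ])))))
  where
  step : ∀ n → 2 * ((1 + n) * (1 + n)) + (1 + n) * (2 + n) ≡ 3 * ((1 + n) * (1 + n)) + (1 + n)
  step = ℕ-Solver.solve-∀
  double : 2 * (suc n * suc n + triangular (suc n)) ≡ 3 * (suc n * suc n) + suc n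
  double = ≡.trans (≡.trans (ℕ.*-distribˡ-+ 2 (suc n * suc n) (triangular (suc n)))
    (cong (λ x → 2 * (suc n * suc n) + x) (triangular-double (suc n)))) (step n)

bilateralTerm : ℤ → Series
bilateralTerm k = sign k · q ^ₛ 3k²-k k

bilateralTerm-shanks : ∀ k m → 2 * m ≡ 3k²-k k →
  bilateralTerm k ≗ (-ₛ 1ₛ) ^ₛ ∣ k ∣ *ₛ (q ^ₛ 2) ^ₛ m
bilateralTerm-shanks k m 2m≡ = trans (-1^-· ∣ k ∣ (q ^ₛ 3k²-k k))
  (*ₛ-congˡ ((-ₛ 1ₛ) ^ₛ ∣ k ∣)
    (trans (^ₛ-≡ q (≡.trans (≡.sym 2m≡) (ℕ.*-comm 2 m))) (sym (^ₛ-* q 2 m))))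

-- The half that contains k = 0 has one term more, so the left side runs over |k| ≤ n. Each
-- induction step adds the terms k = n + 1 and k = -(n + 1), which are the two powers in
-- `shanks-suc`.
partialSum-bilateral : ∀ n →
  partialSum (λ n → bilateralTerm (+ n)) (suc n) +ₛ partialSum (λ n → bilateralTerm -[1+ n ]) n
    ≗ ⟨ q ^ₛ 2 ⨾ q ^ₛ 2 ⟩[ n ] *ₛ shanks (q ^ₛ 2) q²₀ n (suc n)
partialSum-bilateral zero    = begin
  0ₛ +ₛ bilateralTerm (+ 0) +ₛ 0ₛ ≈⟨ (λ i → zero-case (1ₛ i)) ⟩
  1ₛ                              ≈⟨ shanks-one (q ^ₛ 2) q²₀ 0 ⟨
  shanks (q ^ₛ 2) q²₀ 0 1         ≈⟨ *-identityˡ (shanks (q ^ₛ 2) q²₀ 0 1) ⟨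
  1ₛ *ₛ shanks (q ^ₛ 2) q²₀ 0 1   ∎
  where
  open ≗-Reasoning
  zero-case : ∀ a → 0ℤ ℤ.+ 1ℤ ℤ.* a ℤ.+ 0ℤ ≡ a
  zero-case = ℤ-Solver.solve-∀
partialSum-bilateral (suc n) = begin
  (a +ₛ bilateralTerm (+ suc n)) +ₛ (b +ₛ bilateralTerm -[1+ n ])
    ≈⟨ solve 4 (λ a s b t → (a :+ s) :+ (b :+ t) := (a :+ b) :+ (s :+ t)) refl
         a (bilateralTerm (+ suc n)) b (bilateralTerm -[1+ n ]) ⟩
  (a +ₛ b) +ₛ (bilateralTerm (+ suc n) +ₛ bilateralTerm -[1+ n ])
    ≈⟨ +-cong (partialSum-bilateral n)
         (+-cong (bilateralTerm-shanks (+ suc n) (suc n * suc n + triangular n) (3k²-k-+suc n))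
                 (bilateralTerm-shanks -[1+ n ] (suc n * suc n + triangular (suc n)) (3k²-k--suc n))) ⟩
  _
    ≈⟨ shanks-suc (q ^ₛ 2) q²₀ n ⟨
  ⟨ q ^ₛ 2 ⨾ q ^ₛ 2 ⟩[ suc n ] *ₛ shanks (q ^ₛ 2) q²₀ (suc n) (suc (suc n)) ∎
  where
  open ≗-Reasoning
  a = partialSum (λ n → bilateralTerm (+ n)) (suc n)
  b = partialSum (λ n → bilateralTerm -[1+ n ]) n

-- Passage to the limit.

⟨q⟩∞ ⟨q²⟩∞ ⟨-q⟩∞ : Series
⟨q⟩∞  = ⟨ q ⨾ q ⟩∞[ q₀ ]
⟨q²⟩∞ = ⟨ q ^ₛ 2 ⨾ q ^ₛ 2 ⟩∞[ q²₀ ]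
⟨-q⟩∞ = ⟨ -ₛ q ⨾ q ⟩∞[ q₀ ]

⟨⨾⟩∞-≈[] : ∀ z p p₀ n → ⟨ z ⨾ p ⟩∞[ p₀ ] ≈[ n ] ⟨ z ⨾ p ⟩[ n ]
⟨⨾⟩∞-≈[] z p p₀ = lim-≈[] (⟨⨾⟩-converges z p p₀) (λ _ → ≡.refl)

∑∞-euler : ∑∞ _ q^[2n²+n]/⟨q⨾q⟩-summable ≗ ⟨-q⟩∞
∑∞-euler = ≈[]⇒≗ λ n → let open ≈[]-Reasoning n in begin
  ∑∞ _ q^[2n²+n]/⟨q⨾q⟩-summable
    ≈⟨ lim-≈[] q^[2n²+n]/⟨q⨾q⟩-summable (λ _ → ≡.refl) n ⟩
  partialSum (λ n → q ^ₛ (2 * n ^ 2 + n) /ₛ ⟨ q ⨾ q ⟩[ 2 * n + 1 ]) n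
    ≈⟨ exact (partialSum-evenTerm q q₀ n) ⟩
  -- The n paired terms are 2n Euler terms, accurate modulo q^{2n}, which is more than the modulus
  -- q^n requires.
  euler q q₀ 0 (2 * n)
    ≈⟨ ≈[]-≤ (ℕ.m≤n*m n 2) (euler-≈[] q q₀ (2 * n)) ⟩
  ⟨ -ₛ q ⨾ q ⟩[ 2 * n ]
    ≈⟨ ≈[]-≤ (ℕ.m≤n*m n 2) (⟨⨾⟩∞-≈[] (-ₛ q) q q₀ (2 * n)) ⟨
  ⟨-q⟩∞ ∎

∑ℤ-pentagonal : ∑ℤ bilateralTerm sign·q^[3k²-k]-summable ≗ ⟨q²⟩∞
∑ℤ-pentagonal = ≈[]⇒≗ λ n → let open ≈[]-Reasoning n in begin
  ∑ℤ bilateralTerm sign·q^[3k²-k]-summable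
    ≈⟨ +ₛ-≈[]
         -- The nonnegative half is cut after n + 1 terms to match `partialSum-bilateral`; its
         -- precision q^{n+1} is then weakened to q^n.
         (≈[]-≤ (ℕ.n≤1+n n) (lim-≈[] (proj₁ sign·q^[3k²-k]-summable) (λ _ → ≡.refl) (suc n)))
         (lim-≈[] (proj₂ sign·q^[3k²-k]-summable) (λ _ → ≡.refl) n) ⟩
  partialSum (λ n → bilateralTerm (+ n)) (suc n) +ₛ partialSum (λ n → bilateralTerm -[1+ n ]) n
    ≈⟨ exact (partialSum-bilateral n) ⟩
  ⟨ q ^ₛ 2 ⨾ q ^ₛ 2 ⟩[ n ] *ₛ shanks (q ^ₛ 2) q²₀ n (suc n)
    ≈⟨ shanks-≈[] (q ^ₛ 2) q²₀ n ⟩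
  ⟨ q ^ₛ 2 ⨾ q ^ₛ 2 ⟩[ n ]
    ≈⟨ ⟨⨾⟩∞-≈[] (q ^ₛ 2) (q ^ₛ 2) q²₀ n ⟨
  ⟨q²⟩∞ ∎

⟨⨾⟩∞-square : ⟨q⟩∞ *ₛ ⟨-q⟩∞ ≗ ⟨q²⟩∞
⟨⨾⟩∞-square = ≈[]⇒≗ λ n → let open ≈[]-Reasoning n in begin
  ⟨q⟩∞ *ₛ ⟨-q⟩∞
    ≈⟨ *ₛ-≈[] (⟨⨾⟩∞-≈[] q q q₀ n) (⟨⨾⟩∞-≈[] (-ₛ q) q q₀ n) ⟩
  ⟨ q ⨾ q ⟩[ n ] *ₛ ⟨ -ₛ q ⨾ q ⟩[ n ]
    ≈⟨ exact (⟨⨾⟩-square q q₀ n) ⟩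
  ⟨ q ^ₛ 2 ⨾ q ^ₛ 2 ⟩[ n ]
    ≈⟨ ⟨⨾⟩∞-≈[] (q ^ₛ 2) (q ^ₛ 2) q²₀ n ⟨
  ⟨q²⟩∞ ∎

⟨q²⟩∞/ₛ⟨q⟩∞ : ⟨q²⟩∞ /ₛ ⟨q⟩∞ ≗ ⟨-q⟩∞
⟨q²⟩∞/ₛ⟨q⟩∞ = begin
  ⟨q²⟩∞ *ₛ recip ⟨q⟩∞
    ≈⟨ *ₛ-congʳ (recip ⟨q⟩∞) ⟨⨾⟩∞-square ⟨
  ⟨q⟩∞ *ₛ ⟨-q⟩∞ *ₛ recip ⟨q⟩∞
    ≈⟨ solve 3 (λ a b c → a :* b :* c := b :* (a :* c)) refl ⟨q⟩∞ ⟨-q⟩∞ (recip ⟨q⟩∞) ⟩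
  ⟨-q⟩∞ *ₛ (⟨q⟩∞ *ₛ recip ⟨q⟩∞)
    ≈⟨ *ₛ-congˡ ⟨-q⟩∞ (recip-inverseʳ ⟨q⟩∞ (⟨⨾⟩∞-constant q q q₀ q₀)) ⟩
  ⟨-q⟩∞ *ₛ 1ₛ
    ≈⟨ *-identityʳ ⟨-q⟩∞ ⟩
  ⟨-q⟩∞ ∎
  where open ≗-Reasoning

∑ℤ/ₛ⟨q⟩∞ : 1ₛ /ₛ ⟨q⟩∞ *ₛ ∑ℤ bilateralTerm sign·q^[3k²-k]-summable ≗ ⟨q²⟩∞ /ₛ ⟨q⟩∞
∑ℤ/ₛ⟨q⟩∞ = begin
  1ₛ *ₛ recip ⟨q⟩∞ *ₛ ∑ℤ bilateralTerm sign·q^[3k²-k]-summable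
    ≈⟨ *ₛ-cong (*-identityˡ (recip ⟨q⟩∞)) ∑ℤ-pentagonal ⟩
  recip ⟨q⟩∞ *ₛ ⟨q²⟩∞
    ≈⟨ *ₛ-comm (recip ⟨q⟩∞) ⟨q²⟩∞ ⟩
  ⟨q²⟩∞ *ₛ recip ⟨q⟩∞ ∎
  where open ≗-Reasoning

corollary5p6 : (∑∞ (λ n → q ^ₛ (2 * n ^ 2 + n) /ₛ ⟨ q ⨾ q ⟩[ 2 * n + 1 ]) q^[2n²+n]/⟨q⨾q⟩-summable
    ≗ 1ₛ /ₛ ⟨ q ⨾ q ⟩∞[ q₀ ] *ₛ ∑ℤ (λ k → sign k · q ^ₛ 3k²-k k) sign·q^[3k²-k]-summable)
    × (1ₛ /ₛ ⟨ q ⨾ q ⟩∞[ q₀ ] *ₛ ∑ℤ (λ k → sign k · q ^ₛ 3k²-k k) sign·q^[3k²-k]-summable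
    ≗ ⟨ q ^ₛ 2 ⨾ q ^ₛ 2 ⟩∞[ q²₀ ] /ₛ ⟨ q ⨾ q ⟩∞[ q₀ ])
    × (⟨ q ^ₛ 2 ⨾ q ^ₛ 2 ⟩∞[ q²₀ ] /ₛ ⟨ q ⨾ q ⟩∞[ q₀ ]
    ≗ ⟨ -ₛ q ⨾ q ⟩∞[ q₀ ])
-- The two sides of the first equality meet at (-q; q)_∞: the left by Euler's series, the right
-- through the other two equalities.
corollary5p6 = trans ∑∞-euler (sym (trans ∑ℤ/ₛ⟨q⟩∞ ⟨q²⟩∞/ₛ⟨q⟩∞)) , ∑ℤ/ₛ⟨q⟩∞ , ⟨q²⟩∞/ₛ⟨q⟩∞
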